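{- Any deterministic algorithm for triangle detection in the CONGEST$(1)$ model requires $\Omega(\log^* N)$ rounds, even for graphs of maximum degree $2$ with only $6$ nodes, given a namespace of size $N$. That is, there exist constants $c>0$ and $N_0$ such that for every $N\ge N_0$, every deterministic algorithm in the CONGEST$(1)$ model that solves the triangle detection problem on all $6$-node graphs of maximum degree at most $2$ whose nodes have distinct IDs from $[N]$ uses at least $c\log^* N$ rounds.
   Context: CONGEST$(1)$ model (with $KT_1$ knowledge): the network is a simple undirected graph whose nodes have distinct IDs in the namespace $[N]=\{1,\dots,N\}$. Initially each node knows its own ID and the IDs of its neighbors (and the global parameters: the number of nodes and $N$), and nothing else about the graph. Computation proceeds in synchronous rounds; in each round each node sends a message of exactly one bit to each of its neighbors (possibly different messages to different neighbors). The message sent in a round is a function of the initial knowledge of the node and the messages received in previous rounds; local computation is unbounded. After the last round each node produces an output determined by its initial knowledge and all messages it received. An algorithm solves a problem on a class of graphs if it is correct for every graph in the class and every assignment of distinct IDs from $[N]$. Triangle detection problem: if the graph contains no triangle then every node outputs NO; if the graph contains a triangle then at least one node outputs YES. $\log^* N$ is the iterated logarithm: the number of times $\log_2$ must be applied to $N$ until the result is at most $1$. -}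

module Defs where

open import Data.Bool using (Bool)
open import Data.Fin using (Fin; _≟_)
open import Data.Fin.Properties using (any?)
open import Data.Fin.Subset using (Subset; ∣_∣)
open import Data.Maybe as Maybe using (Maybe)
open import Data.Nat using (ℕ; zero; suc; _≤_; _<_; s≤s; z≤n; ⌈_/2⌉)
open import Data.Nat.Induction using (<-wellFounded)
open import Data.Nat.Logarithm using (⌈log₂_⌉)
open import Data.Nat.Logarithm.Core using (⌈log2⌉)
open import Data.Nat.Properties using (≤-trans; ⌈n/2⌉≤n; ⌈n/2⌉<n)
open import Data.Product using (_,_; _×_; ∃-syntax; proj₁)
open import Data.Vec using (Vec; []; _∷_; tabulate)
open import Function using (_∘_)
open import Function.Definitions using (Injective)
open import Induction.WellFounded using (Acc; acc)
open import Level using (0ℓ)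
open import Relation.Binary using (Rel; Decidable; Symmetric; Irreflexive)
open import Relation.Binary.PropositionalEquality using (_≡_)
open import Relation.Nullary using (Dec; ¬_; does; _×-dec_)
open import Relation.Nullary.Decidable using (dec⇒maybe)

⌈log2⌉-< : ∀ n (a : Acc _<_ (suc n)) → ⌈log2⌉ (suc n) a < suc n
⌈log2⌉-< zero    _        = s≤s z≤n
⌈log2⌉-< (suc n) (acc rs) =
  s≤s (≤-trans (⌈log2⌉-< ⌈ n /2⌉ (rs (⌈n/2⌉<n n))) (s≤s (⌈n/2⌉≤n n)))

-- Iterating ⌈log₂_⌉ takes exactly as many steps to reach a value ≤ 1 as
-- iterating the real log₂: ⌈log₂ ⌈x⌉⌉ = ⌈log₂ x⌉ for every real x > 1, and
-- ⌈x⌉ ≤ 1 iff x ≤ 1.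
log*-acc : ∀ n → Acc _<_ n → ℕ
log*-acc 0                 _        = 0
log*-acc 1                 _        = 0
log*-acc n@(suc n′@(suc _)) (acc rs) =
  suc (log*-acc ⌈log₂ n ⌉ (rs (⌈log2⌉-< n′ (<-wellFounded n))))

log* : ℕ → ℕ
log* n = log*-acc n (<-wellFounded n)

record SimpleGraph (n : ℕ) : Set₁ where
  infix 4 _~_ _~?_
  field
    _~_    : Rel (Fin n) 0ℓ
    _~?_   : Decidable _~_
    sym    : Symmetric _~_
    irrefl : Irreflexive _≡_ _~_

  degree : Fin n → ℕ
  degree v = ∣ tabulate (λ u → does (v ~? u)) ∣

  -- Irreflexivity makes the three vertices distinct.
  HasTriangle : Set
  HasTriangle = ∃[ u ] ∃[ v ] ∃[ w ] u ~ v × v ~ w × w ~ u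

MaxDegree≤ : ∀ {n} → ℕ → SimpleGraph n → Set
MaxDegree≤ d G = ∀ v → SimpleGraph.degree G v ≤ d

-- The namespace {1,…,N} is represented by Fin N.
record Network (n N : ℕ) : Set₁ where
  field
    graph        : SimpleGraph n
    ID           : Fin n → Fin N
    ID-injective : Injective _≡_ _≡_ ID

  open SimpleGraph graph public

  neighbourWithID? : ∀ v i → Dec (∃[ u ] v ~ u × ID u ≡ i)
  neighbourWithID? v i = any? (λ u → (v ~? u) ×-dec (ID u ≟ i))

-- The global parameters n and N are absent because an algorithm is
-- considered for fixed values of them.
record Knowledge (N : ℕ) : Set where
  constructor knows
  field
    ownID        : Fin N
    neighbourIDs : Subset N

-- The bits received in one round, indexed by the sender's ID; the entry is
-- `nothing` exactly when no neighbour has that ID.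
Inbox : ℕ → Set
Inbox N = Vec (Maybe Bool) N

data Answer : Set where
  YES NO : Answer

-- Histories list the most recent round first.  The last argument of `send`
-- is the ID of the neighbour the bit is addressed to.
record Algorithm (N : ℕ) : Set where
  field
    rounds : ℕ
    send   : ∀ {t} → Knowledge N → Vec (Inbox N) t → Fin N → Bool
    output : Knowledge N → Vec (Inbox N) rounds → Answer

module Execution {n N : ℕ} (A : Algorithm N) (net : Network n N) where
  open Algorithm A
  open Network net

  knowledge : Fin n → Knowledge N
  knowledge v = knows (ID v) (tabulate (λ i → does (neighbourWithID? v i)))

  mutual
    history : ∀ t → Fin n → Vec (Inbox N) t
    history zero    v = []
    history (suc t) v = tabulate (received t v) ∷ history t v

    -- What v receives, in the round following t completed rounds, from its
    -- neighbour with ID i.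
    received : ℕ → Fin n → Fin N → Maybe Bool
    received t v i = Maybe.map (message t v ∘ proj₁) (dec⇒maybe (neighbourWithID? v i))

    message : ℕ → Fin n → Fin n → Bool
    message t v u = send (knowledge u) (history t u) (ID v)

  answer : Fin n → Answer
  answer v = output (knowledge v) (history rounds v)

DetectsTrianglesOn : ∀ {n N} → (SimpleGraph n → Set) → Algorithm N → Set₁
DetectsTrianglesOn {n} {N} Class A =
  (net : Network n N) → let open Network net; open Execution A net in
  Class graph →
    (¬ HasTriangle → ∀ v → answer v ≡ NO) ×
    (HasTriangle → ∃[ v ] answer v ≡ YES)

{-# OPTIONS --safe #-}
module Submission where

-- Colour a triangle of IDs, one from each of three disjoint parts, by the bits
-- sent along its edges.  If N is large compared with the number of colours, some
-- two IDs in each part span eight triangles of a single colour.  Place these six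
-- IDs on a double cover of the triangle: a node cannot tell the cover from the
-- triangle formed by itself and its two neighbours, since those triangles all have
-- the same transcript.  Two disjoint triangles and the hexagon are both double covers
-- of the triangle, and every node of the former has the same neighbours in a
-- suitable hexagon, where it answers NO.

open import Defs
open import Data.Bool using (Bool; true; false; if_then_else_; _xor_)
import Data.Bool.Properties as Bool
open import Data.Fin as Fin
  using (Fin; toℕ; fromℕ<; inject≤; combine; quotient; remainder; funToFin; finToFun)
open import Data.Fin.Properties as Fin
  using (all?; any?; pigeonhole; <⇒≢; inject≤-injective; remQuot-combine; combine-injective;
         finToFun-funToFin; toℕ-fromℕ<; *↔×; 2↔Bool)
open import Data.Integer as ℤ using (+_; +≤+)
import Data.Integer.Properties as ℤ
import Data.Maybe as Maybe
open import Data.Nat as ℕ using (ℕ; zero; suc; z≤n; s≤s; _^_)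
open import Data.Nat.Induction using (<-wellFounded)
open import Data.Nat.Logarithm using (⌈log₂_⌉; ⌈log₂⌉-mono-≤; ⌈log₂2^n⌉≡n)
import Data.Nat.Properties as ℕ
open import Data.Nat.Solver using (module +-*-Solver)
open import Data.Product using (_×_; _,_; Σ-syntax; ∃-syntax; proj₁; proj₂)
open import Data.Product.Function.NonDependent.Propositional using (_×-↔_)
open import Data.Rational using (ℚ; 0ℚ; _<_; _≤_; _*_; _/_; toℚᵘ)
import Data.Rational.Properties as ℚ
import Data.Rational.Unnormalised as ℚᵘ
import Data.Rational.Unnormalised.Properties as ℚᵘ
open import Data.Vec using (Vec; []; _∷_; _⊛_; lookup; tabulate; replicate)
open import Data.Vec.Properties using (≡-dec; lookup-⊛; lookup∘tabulate; tabulate-cong)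
open import Function using (_∘_; Injection; Inverse; _↔_; mk⇔)
open import Function.Construct.Composition using (_↔-∘_)
open import Function.Construct.Identity using (↔-id)
open import Function.Construct.Symmetry using (↔-sym)
open import Function.Definitions using (Injective)
open import Function.Properties.Inverse using (↔⇒↣)
open import Induction.WellFounded using (Acc; acc)
open import Level using (Level)
open import Relation.Binary.PropositionalEquality
open import Relation.Nullary using (Dec; yes; no; ¬_; ¬?; _×-dec_; does; contradiction)
open import Relation.Nullary.Decidable using (dec⇒maybe; does-⇔; from-yes)

private variable
  a b c : Level
  k m n M N : ℕ

-- Monochromatic boxes by iterated pigeonhole.

-- A code is a pair of elements of Fin (suc k) together with their common colour.
twinCodes : ℕ → ℕ
twinCodes k = suc k ℕ.* suc k ℕ.* k

decodePair : Fin (n ℕ.* n) → Bool → Fin n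
decodePair {n} p s = if s then quotient {n} n p else remainder {n} n p

member : k ℕ.< M → Fin (twinCodes k) → Bool → Fin M
member {k} k<M z s = inject≤ (decodePair (quotient {suc k ℕ.* suc k} k z) s) k<M

colour : Fin (twinCodes k) → Fin k
colour {k} = remainder {suc k ℕ.* suc k} k

-- Pigeonhole on the first `suc k` points alone: the number of codes then depends on k and not on M,
-- which lets codes serve as colours in a lower dimension.
twins : (k<M : k ℕ.< M) (f : Fin M → Fin k) →
        ∃[ z ] Injective _≡_ _≡_ (member k<M z) × (∀ s → f (member k<M z s) ≡ colour z)
twins {k} {M} k<M f with pigeonhole (ℕ.n<1+n k) (λ i → f (inject≤ i k<M))
... | i , j , i<j , fi≡fj = z , injective , monochromatic
  where
  z = combine (combine i j) (f (inject≤ i k<M))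

  member≡ : ∀ s → member k<M z s ≡ inject≤ (if s then i else j) k<M
  member≡ s = cong (λ p → inject≤ p k<M) (begin
    decodePair (quotient {suc k ℕ.* suc k} k z) s
      ≡⟨ cong (λ p → decodePair (proj₁ p) s) (remQuot-combine (combine i j) (f (inject≤ i k<M))) ⟩
    decodePair (combine i j) s
      ≡⟨ cong (λ p → if s then proj₁ p else proj₂ p) (remQuot-combine i j) ⟩
    (if s then i else j) ∎)
    where open ≡-Reasoning

  distinct : ∀ s s′ → (if s then i else j) ≡ (if s′ then i else j) → s ≡ s′
  distinct false false _   = refl
  distinct true  true  _   = refl
  distinct false true  j≡i = contradiction (sym j≡i) (<⇒≢ i<j)
  distinct true  false i≡j = contradiction i≡j (<⇒≢ i<j)

  injective : Injective _≡_ _≡_ (member k<M z)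
  injective {s} {s′} eq = distinct s s′
    (inject≤-injective k<M k<M _ _ (trans (sym (member≡ s)) (trans eq (member≡ s′))))

  f≡ : ∀ s → f (inject≤ (if s then i else j) k<M) ≡ f (inject≤ i k<M)
  f≡ true  = refl
  f≡ false = sym fi≡fj

  monochromatic : ∀ s → f (member k<M z s) ≡ colour z
  monochromatic s = trans (cong f (member≡ s))
    (trans (f≡ s) (sym (cong proj₂ (remQuot-combine (combine i j) _))))

-- The number of points per coordinate that suffices for a d-dimensional box under k colours; each
-- coordinate removed turns colours into codes.
boxSize : ℕ → ℕ → ℕ
boxSize zero    k = suc k
boxSize (suc d) k = boxSize d (twinCodes k)

k<boxSize : ∀ d k → k ℕ.< boxSize d k
k<boxSize zero    k = ℕ.≤-refl
k<boxSize (suc d) k = ℕ.≤-<-trans (ℕ.m≤n*m k (suc k ℕ.* suc k)) (k<boxSize d (twinCodes k))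

-- Colouring the tails of f by the codes of their twins reduces the dimension by one.
monochromaticBox : ∀ d → boxSize d k ℕ.≤ M → (f : Vec (Fin M) d → Fin k) →
  Σ[ x ∈ Vec (Bool → Fin M) d ]
    (∀ i → Injective _≡_ _≡_ (lookup x i)) × (∃[ κ ] (∀ s → f (x ⊛ s) ≡ κ))
monochromaticBox zero _ f = [] , (λ ()) , f [] , λ { [] → refl }
monochromaticBox {k} {M} (suc d) size f
  using k<M ← ℕ.≤-trans (k<boxSize (suc d) k) size
  with monochromaticBox d size (λ r → proj₁ (twins k<M (λ p → f (p ∷ r))))
... | x , x-injective , z , mono = member k<M z ∷ x , injective , colour z ,
  λ { (b ∷ s) → proj₂ (twinsAt s) b }
  where
  -- All tails in the box have the code z, hence the same twins with the same colour.
  twinsAt : ∀ s → Injective _≡_ _≡_ (member k<M z) × (∀ b → f (member k<M z b ∷ (x ⊛ s)) ≡ colour z)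
  twinsAt s = subst
    (λ z → Injective _≡_ _≡_ (member k<M z) × (∀ b → f (member k<M z b ∷ (x ⊛ s)) ≡ colour z))
    (mono s) (proj₂ (twins k<M (λ p → f (p ∷ (x ⊛ s)))))

  injective : ∀ i → Injective _≡_ _≡_ (lookup (member k<M z ∷ x) i)
  -- This property concerns z alone, so any one tail of the box supplies it.
  injective Fin.zero    = proj₁ (twinsAt (replicate d false))
  injective (Fin.suc i) = x-injective i

-- Growth of the box size, and a bound on the iterated logarithm.

boxSizeExponent : ℕ → ℕ → ℕ
boxSizeExponent zero    e = suc e
boxSizeExponent (suc d) e = boxSizeExponent d (suc e ℕ.+ suc e ℕ.+ e)

suc-bound : ∀ {k} e → k ℕ.≤ 2 ^ e → suc k ℕ.≤ 2 ^ suc e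
suc-bound {k} e k≤2^e = begin
  1 ℕ.+ k                   ≤⟨ ℕ.+-mono-≤ (ℕ.m^n>0 2 e) k≤2^e ⟩
  2 ^ e ℕ.+ 2 ^ e           ≡⟨ cong (2 ^ e ℕ.+_) (ℕ.+-identityʳ (2 ^ e)) ⟨
  2 ^ suc e                 ∎
  where open ℕ.≤-Reasoning

-- Removing a coordinate cubes the number of colours up to a factor of four, so e becomes 3e + 2 and
-- for fixed d the exponent is linear in e.
boxSize-bound : ∀ d {k} e → k ℕ.≤ 2 ^ e → boxSize d k ℕ.≤ 2 ^ boxSizeExponent d e
boxSize-bound zero    e k≤2^e = suc-bound e k≤2^e
boxSize-bound (suc d) {k} e k≤2^e = boxSize-bound d (suc e ℕ.+ suc e ℕ.+ e) (begin
  suc k ℕ.* suc k ℕ.* k                 ≤⟨ ℕ.*-mono-≤ (ℕ.*-mono-≤ 1+k≤ 1+k≤) k≤2^e ⟩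
  2 ^ suc e ℕ.* 2 ^ suc e ℕ.* 2 ^ e     ≡⟨ cong (ℕ._* 2 ^ e) (ℕ.^-distribˡ-+-* 2 (suc e) (suc e)) ⟨
  2 ^ (suc e ℕ.+ suc e) ℕ.* 2 ^ e       ≡⟨ ℕ.^-distribˡ-+-* 2 (suc e ℕ.+ suc e) e ⟨
  2 ^ (suc e ℕ.+ suc e ℕ.+ e)           ∎)
  where
  open ℕ.≤-Reasoning
  1+k≤ = suc-bound e k≤2^e

⌈log₂n⌉<n : ∀ {n} → 0 ℕ.< n → ⌈log₂ n ⌉ ℕ.< n
⌈log₂n⌉<n {suc n} _ = ⌈log2⌉-< n (<-wellFounded (suc n))

-- This crude bound suffices because the argument bounds the logarithm of N itself linearly in the
-- number of rounds.
log*-acc≤1+⌈log₂⌉ : ∀ n (rec : Acc ℕ._<_ n) → log*-acc n rec ℕ.≤ suc ⌈log₂ n ⌉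
log*-acc≤1+⌈log₂⌉ 0 _ = z≤n
log*-acc≤1+⌈log₂⌉ 1 _ = z≤n
log*-acc≤1+⌈log₂⌉ n@(suc n′@(suc _)) (acc rs) = s≤s (ℕ.≤-trans
  (log*-acc≤1+⌈log₂⌉ ⌈log₂ n ⌉ (rs (⌈log2⌉-< n′ (<-wellFounded n))))
  (⌈log₂n⌉<n {⌈log₂ n ⌉} (s≤s z≤n)))

log*≤1+⌈log₂⌉ : ∀ n → log* n ℕ.≤ suc ⌈log₂ n ⌉
log*≤1+⌈log₂⌉ n = log*-acc≤1+⌈log₂⌉ n (<-wellFounded n)

-- Simulating a run by runs on local networks.

map-dec⇒maybe-cong : {A : Set a} {B : Set b} {C : Set c} {f : A → C} {g : B → C}
  (A? : Dec A) (B? : Dec B) → (A → B) → (B → A) → (∀ x y → f x ≡ g y) →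
  Maybe.map f (dec⇒maybe A?) ≡ Maybe.map g (dec⇒maybe B?)
map-dec⇒maybe-cong (yes x) (yes y) _ _ f≡g = cong Maybe.just (f≡g x y)
map-dec⇒maybe-cong (yes x) (no ¬y) to _ _  = contradiction (to x) ¬y
map-dec⇒maybe-cong (no ¬x) (yes y) _ from _ = contradiction (from y) ¬x
map-dec⇒maybe-cong (no _)  (no _)  _ _ _   = refl

-- Opening this at a fixed algorithm keeps the network an explicit argument, so that runs on
-- different networks can be compared.
module Run {N} (A : Algorithm N) {n} (net : Network n N) = Execution A net

module LocalSimulation (A : Algorithm N) (net : Network n N) where

  open Algorithm A
  open Run A
  open Network net using (_~_; ID; neighbourWithID?) renaming (sym to ~-sym)

  -- Each node v acts as `π v` in a network `local v` of its own, which matches its neighbourhood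
  -- and the IDs there. Adjacent nodes may have different local networks; `agree` makes their
  -- messages compatible.
  module _ (local : Fin n → Network m N) (π : Fin n → Fin m)
    (own-ID : ∀ v → Network.ID (local v) (π v) ≡ ID v)
    (~⇒ : ∀ {v u} → v ~ u → Network._~_ (local v) (π v) (π u) × Network.ID (local v) (π u) ≡ ID u)
    (~⇐ : ∀ {v j} → Network._~_ (local v) (π v) j → ∃[ u ] v ~ u × π u ≡ j)
    (agree : ∀ {t} → t ℕ.< rounds → ∀ v v′ i j → message (local v) t i j ≡ message (local v′) t i j)
    where

    private
      neighbour⇒ : ∀ {v k} → ∃[ u ] v ~ u × ID u ≡ k →
        ∃[ j ] Network._~_ (local v) (π v) j × Network.ID (local v) j ≡ k
      neighbour⇒ (u , v~u , refl) = π u , ~⇒ v~u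

      neighbour⇐ : ∀ {v k} → ∃[ j ] Network._~_ (local v) (π v) j × Network.ID (local v) j ≡ k →
        ∃[ u ] v ~ u × ID u ≡ k
      neighbour⇐ (j , v~j , refl) with ~⇐ v~j
      ... | u , v~u , refl = u , v~u , sym (proj₂ (~⇒ v~u))

    knowledge≡ : ∀ v → knowledge net v ≡ knowledge (local v) (π v)
    knowledge≡ v = cong₂ knows (sym (own-ID v)) (tabulate-cong λ k →
      does-⇔ (mk⇔ neighbour⇒ neighbour⇐)
        (neighbourWithID? v k) (Network.neighbourWithID? (local v) (π v) k))

    history≡ : ∀ {t} → t ℕ.≤ rounds → ∀ v → history net t v ≡ history (local v) t (π v)
    history≡ {zero}  _   v = refl
    history≡ {suc t} t<T v = cong₂ _∷_ (tabulate-cong received≡) (history≡ t≤T v)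
      where
      t≤T = ℕ.<⇒≤ t<T

      message≡ : ∀ {k} (p : ∃[ u ] v ~ u × ID u ≡ k)
        (q : ∃[ j ] Network._~_ (local v) (π v) j × Network.ID (local v) j ≡ k) →
        message net t v (proj₁ p) ≡ message (local v) t (π v) (proj₁ q)
      message≡ (u , v~u , refl) (j , _ , IDj≡IDu)
        with refl ← Network.ID-injective (local v) (trans IDj≡IDu (sym (proj₂ (~⇒ v~u))))
        = let open ≡-Reasoning in begin
        send (knowledge net u) (history net t u) (ID v)
          ≡⟨ cong₂ (λ K h → send K h (ID v)) (knowledge≡ u) (history≡ t≤T u) ⟩
        send (knowledge (local u) (π u)) (history (local u) t (π u)) (ID v)
          ≡⟨ cong (send _ _) (proj₂ (~⇒ (~-sym v~u))) ⟨
        message (local u) t (π v) (π u)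
          -- The induction hypothesis puts the sender u in its own local network; `agree` carries
          -- the bit over to that of the receiver v.
          ≡⟨ agree t<T u v (π v) (π u) ⟩
        message (local v) t (π v) (π u) ∎

      received≡ : ∀ k → received net t v k ≡ received (local v) t (π v) k
      received≡ k = map-dec⇒maybe-cong
        (neighbourWithID? v k) (Network.neighbourWithID? (local v) (π v) k)
        neighbour⇒ neighbour⇐ message≡

    answer≡ : ∀ v → answer net v ≡ answer (local v) (π v)
    answer≡ v = cong₂ output (knowledge≡ v) (history≡ ℕ.≤-refl v)

-- Double covers of the triangle.

nodes : Fin 6 ↔ (Bool × Fin 3)
nodes = (2↔Bool ×-↔ ↔-id (Fin 3)) ↔-∘ *↔×

-- Tells apart the two nodes above one vertex of the triangle; `part` is that vertex.
side : Fin 6 → Bool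
side = proj₁ ∘ Inverse.to nodes

part : Fin 6 → Fin 3
part = proj₂ ∘ Inverse.to nodes

complete : ∀ n → SimpleGraph n
complete n = record
  { _~_    = _≢_
  ; _~?_   = λ i j → ¬? (i Fin.≟ j)
  ; sym    = ≢-sym
  ; irrefl = λ i≡j i≢j → i≢j i≡j
  }

-- The double covers of the triangle: τ i j says whether the two edges above {i,j} cross over.
record Voltage : Set where
  field
    τ      : Fin 3 → Fin 3 → Bool
    τ-sym  : ∀ i j → τ i j ≡ τ j i
    τ-diag : ∀ i → τ i i ≡ false

  cover : SimpleGraph 6
  cover = record
    { _~_    = λ u v → part u ≢ part v × side v ≡ side u xor τ (part u) (part v)
    ; _~?_   = λ u v → ¬? (part u Fin.≟ part v) ×-dec (side v Bool.≟ side u xor τ (part u) (part v))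
    ; sym    = λ { {u} {v} (i≢j , eq) → ≢-sym i≢j , (begin
        side u
          ≡⟨ Bool.xor-identityʳ (side u) ⟨
        side u xor false
          ≡⟨ cong (side u xor_) (Bool.xor-same (τ (part u) (part v))) ⟨
        side u xor (τ (part u) (part v) xor τ (part u) (part v))
          ≡⟨ Bool.xor-assoc (side u) _ _ ⟨
        (side u xor τ (part u) (part v)) xor τ (part u) (part v)
          ≡⟨ cong₂ _xor_ (sym eq) (τ-sym (part u) (part v)) ⟩
        side v xor τ (part v) (part u) ∎) }
    ; irrefl = λ { refl (i≢i , _) → i≢i refl }
    }
    where open ≡-Reasoning

  -- Above each j, the side of the neighbour of v, or of v itself when j is `part v`, where `τ-diag`
  -- leaves the side unchanged.
  localSides : Fin 6 → Vec Bool 3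
  localSides v = tabulate (λ j → side v xor τ (part v) j)

open Voltage using (cover; localSides)

untwisted : Voltage
untwisted = record { τ = λ _ _ → false ; τ-sym = λ _ _ → refl ; τ-diag = λ _ → refl }

-- Twisting the edge opposite to i gives the hexagon.
twistedOpposite : Fin 3 → Voltage
twistedOpposite i = record
  { τ      = twist i
  ; τ-sym  = from-yes (all? λ i → all? λ j → all? λ k → twist i j k Bool.≟ twist i k j) i
  ; τ-diag = from-yes (all? λ i → all? λ j → twist i j j Bool.≟ false) i
  }
  where
  twist : Fin 3 → Fin 3 → Fin 3 → Bool
  twist i j k = does (¬? (i Fin.≟ j) ×-dec ¬? (i Fin.≟ k) ×-dec ¬? (j Fin.≟ k))

-- The twisted edge does not meet `part v`, so v has the same two neighbours in this hexagon as in
-- the two triangles.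
twistedOpposite-untwisted : ∀ v → localSides (twistedOpposite (part v)) v ≡ localSides untwisted v
twistedOpposite-untwisted =
  from-yes (all? λ v → ≡-dec Bool._≟_ (localSides (twistedOpposite (part v)) v) (localSides untwisted v))

untwisted-degree : MaxDegree≤ 2 (cover untwisted)
untwisted-degree = from-yes (all? λ v → SimpleGraph.degree (cover untwisted) v ℕ.≤? 2)

twistedOpposite-degree : ∀ i → MaxDegree≤ 2 (cover (twistedOpposite i))
twistedOpposite-degree =
  from-yes (all? λ i → all? λ v → SimpleGraph.degree (cover (twistedOpposite i)) v ℕ.≤? 2)

untwisted-triangle : SimpleGraph.HasTriangle (cover untwisted)
untwisted-triangle = Fin.# 0 , Fin.# 1 , Fin.# 2 , ((λ ()) , refl) , ((λ ()) , refl) , ((λ ()) , refl)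

twistedOpposite-triangleFree : ∀ i → ¬ SimpleGraph.HasTriangle (cover (twistedOpposite i))
twistedOpposite-triangleFree = from-yes (all? λ i → ¬? (any? λ u → any? λ v → any? λ w →
  let open SimpleGraph (cover (twistedOpposite i)) in (u ~? v) ×-dec (v ~? w) ×-dec (w ~? u)))

-- Transcripts of triangles and the fooling argument.

funToFin-injective : (f g : Fin m → Fin n) → funToFin f ≡ funToFin g → f ≗ g
funToFin-injective f g eq i =
  trans (sym (finToFun-funToFin f i)) (trans (cong (λ z → finToFun z i) eq) (finToFun-funToFin g i))

module Fooling (A : Algorithm N) (place : Fin 3 → Fin M → Fin N)
  (place-injective : ∀ {i j p q} → place i p ≡ place j q → i ≡ j × p ≡ q) where

  open Algorithm A
  open Run A

  triangle : Vec (Fin M) 3 → Network 3 N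
  triangle r = record
    { graph        = complete 3
    ; ID           = λ j → place j (lookup r j)
    ; ID-injective = proj₁ ∘ place-injective
    }

  -- The first index is the receiver, the second the sender. All nine ordered pairs are recorded,
  -- the diagonal included, so that equal transcripts give `agree` for all i and j.
  messageBit : Vec (Fin M) 3 → Fin rounds → Fin 3 → Fin 3 → Fin 2
  messageBit r t i j = Inverse.from 2↔Bool (message (triangle r) (toℕ t) i j)

  inboxCode : Vec (Fin M) 3 → Fin rounds → Fin 3 → Fin (2 ^ 3)
  inboxCode r t i = funToFin (messageBit r t i)

  roundCode : Vec (Fin M) 3 → Fin rounds → Fin ((2 ^ 3) ^ 3)
  roundCode r t = funToFin (inboxCode r t)

  transcript : Vec (Fin M) 3 → Fin (((2 ^ 3) ^ 3) ^ rounds)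
  transcript r = funToFin (roundCode r)

  transcript-messageBit : ∀ r r′ → transcript r ≡ transcript r′ → ∀ t i j →
    messageBit r t i j ≡ messageBit r′ t i j
  transcript-messageBit r r′ eq t i =
    funToFin-injective (messageBit r t i) (messageBit r′ t i)
      (funToFin-injective (inboxCode r t) (inboxCode r′ t)
        (funToFin-injective (roundCode r) (roundCode r′) eq t) i)

  transcript-message : ∀ r r′ {t} → transcript r ≡ transcript r′ → t ℕ.< rounds → ∀ i j →
    message (triangle r) t i j ≡ message (triangle r′) t i j
  transcript-message r r′ eq t<T i j =
    subst (λ t → message (triangle r) t i j ≡ message (triangle r′) t i j) (toℕ-fromℕ< t<T)
      (Injection.injective (↔⇒↣ (↔-sym 2↔Bool)) (transcript-messageBit r r′ eq (fromℕ< t<T) i j))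

  module _ (x : Vec (Bool → Fin M) 3) (x-injective : ∀ i → Injective _≡_ _≡_ (lookup x i)) where

    coverNetwork : Voltage → Network 6 N
    coverNetwork V = record
      { graph        = cover V
      ; ID           = λ v → place (part v) (lookup x (part v) (side v))
      ; ID-injective = λ eq → Injection.injective (↔⇒↣ nodes) (same (place-injective eq))
      }
      where
      same : ∀ {s s′ i i′} → i ≡ i′ × lookup x i s ≡ lookup x i′ s′ → (s , i) ≡ (s′ , i′)
      same {i = i} (refl , eq) = cong (_, i) (x-injective i eq)

    module _ (κ : Fin (((2 ^ 3) ^ 3) ^ rounds)) (mono : ∀ s → transcript (x ⊛ s) ≡ κ) where

      -- The local network of v is the triangle on the IDs of v and its neighbours. It has the form
      -- `x ⊛ s`, and `mono` gives all such triangles one transcript, which yields `agree`.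
      cover-answer : ∀ V v → answer (coverNetwork V) v ≡ answer (triangle (x ⊛ localSides V v)) (part v)
      cover-answer V = LocalSimulation.answer≡ A (coverNetwork V)
        (λ v → triangle (x ⊛ localSides V v)) part
        own (λ {v} {u} → neighbour v u) (λ {v} {j} → lift v j)
        (λ t<T v v′ → transcript-message
          (x ⊛ localSides V v) (x ⊛ localSides V v′)
          (trans (mono (localSides V v)) (sym (mono (localSides V v′)))) t<T)
        where
        open Voltage V using (τ; τ-diag)
        open SimpleGraph (cover V) using (_~_)

        localID : ∀ v j → place j (lookup (x ⊛ localSides V v) j) ≡
                          place j (lookup x j (side v xor τ (part v) j))
        localID v j = cong (place j) (trans (lookup-⊛ j x (localSides V v))
          (cong (lookup x j) (lookup∘tabulate (λ j → side v xor τ (part v) j) j)))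

        own : ∀ v → place (part v) (lookup (x ⊛ localSides V v) (part v)) ≡
                    place (part v) (lookup x (part v) (side v))
        own v = trans (localID v (part v)) (cong (λ s → place (part v) (lookup x (part v) s))
          (trans (cong (side v xor_) (τ-diag (part v))) (Bool.xor-identityʳ (side v))))

        neighbour : ∀ v u → v ~ u → part v ≢ part u ×
          place (part u) (lookup (x ⊛ localSides V v) (part u)) ≡
          place (part u) (lookup x (part u) (side u))
        neighbour v u (i≢j , eq) =
          i≢j , trans (localID v (part u)) (cong (λ s → place (part u) (lookup x (part u) s)) (sym eq))

        lift : ∀ v j → part v ≢ j → ∃[ u ] v ~ u × part u ≡ j
        lift v j i≢j = Inverse.from nodes (s , j) ,
          ((λ i≡ → i≢j (trans i≡ part≡)) ,
           trans side≡ (cong (λ j → side v xor τ (part v) j) (sym part≡))) ,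
          part≡
          where
          s = side v xor τ (part v) j

          part≡ : part (Inverse.from nodes (s , j)) ≡ j
          part≡ = cong proj₂ (Inverse.strictlyInverseˡ nodes (s , j))

          side≡ : side (Inverse.from nodes (s , j)) ≡ s
          side≡ = cong proj₁ (Inverse.strictlyInverseˡ nodes (s , j))

      fooled : ¬ DetectsTrianglesOn {6} (MaxDegree≤ 2) A
      fooled detects with proj₂ (detects (coverNetwork untwisted) untwisted-degree) untwisted-triangle
      ... | v , yes≡ = contradiction (begin
        YES
          ≡⟨ yes≡ ⟨
        answer (coverNetwork untwisted) v
          ≡⟨ cover-answer untwisted v ⟩
        answer (triangle (x ⊛ localSides untwisted v)) (part v)
          ≡⟨ cong (λ s → answer (triangle (x ⊛ s)) (part v)) (twistedOpposite-untwisted v) ⟨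
        answer (triangle (x ⊛ localSides twisted v)) (part v)
          ≡⟨ cover-answer twisted v ⟨
        answer (coverNetwork twisted) v
          ≡⟨ proj₁ (detects (coverNetwork twisted) (twistedOpposite-degree (part v)))
               (twistedOpposite-triangleFree (part v)) v ⟩
        NO ∎) λ ()
        where
        open ≡-Reasoning
        -- The hexagon is chosen only after the node v that answers YES is known.
        twisted = twistedOpposite (part v)

-- Constants and the lower bound.

3*2^e≤2^[2+e] : ∀ e → 3 ℕ.* 2 ^ e ℕ.≤ 2 ^ (2 ℕ.+ e)
3*2^e≤2^[2+e] e = ℕ.≤-trans (ℕ.*-monoˡ-≤ (2 ^ e) (ℕ.n≤1+n 3)) (ℕ.≤-reflexive (ℕ.*-assoc 2 2 (2 ^ e)))

-- There are 2 ^ (9 T) transcripts. Three parts of 2 ^ e IDs fit into the namespace, with three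
-- rounded up to four to keep the threshold a power of two. The equation lets the exponent be given
-- in a convenient form.
tooFewRounds : (A : Algorithm N) → ∀ {e} → boxSizeExponent 3 (9 ℕ.* Algorithm.rounds A) ≡ e →
  2 ^ (2 ℕ.+ e) ℕ.≤ N → ¬ DetectsTrianglesOn {6} (MaxDegree≤ 2) A
tooFewRounds {N} A {e} exponent≡e N-large =
  let x , x-injective , κ , mono = monochromaticBox 3 size≤2^e transcript in
  fooled x x-injective κ mono
  where
  T = Algorithm.rounds A

  size≤2^e : boxSize 3 (((2 ^ 3) ^ 3) ^ T) ℕ.≤ 2 ^ e
  size≤2^e = subst (λ e → boxSize 3 (((2 ^ 3) ^ 3) ^ T) ℕ.≤ 2 ^ e) exponent≡e
    (boxSize-bound 3 (9 ℕ.* T) (ℕ.≤-reflexive (ℕ.^-*-assoc 2 9 T)))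

  3*2^e≤N : 3 ℕ.* 2 ^ e ℕ.≤ N
  3*2^e≤N = ℕ.≤-trans (3*2^e≤2^[2+e] e) N-large

  place : Fin 3 → Fin (2 ^ e) → Fin N
  place i p = inject≤ (combine i p) 3*2^e≤N

  place-injective : ∀ {i j p q} → place i p ≡ place j q → i ≡ j × p ≡ q
  place-injective {i} {j} {p} {q} eq =
    combine-injective i p j q (inject≤-injective 3*2^e≤N 3*2^e≤N _ _ eq)

  open Fooling A place place-injective

boxSizeExponent-3 : ∀ t → boxSizeExponent 3 (9 ℕ.* t) ≡ 27 ℕ.+ 243 ℕ.* t
boxSizeExponent-3 = solve 1
  (λ t → con 1 :+ step (step (step (con 9 :* t))) := con 27 :+ con 243 :* t) refl
  where
  open +-*-Solver

  step : Polynomial 1 → Polynomial 1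
  step e = (con 1 :+ e) :+ (con 1 :+ e) :+ e

log*≤1+e : ∀ {n} e → n ℕ.≤ 2 ^ e → log* n ℕ.≤ suc e
log*≤1+e {n} e n≤2^e = begin
  log* n                ≤⟨ log*≤1+⌈log₂⌉ n ⟩
  suc ⌈log₂ n ⌉         ≤⟨ s≤s (⌈log₂⌉-mono-≤ n≤2^e) ⟩
  suc ⌈log₂ 2 ^ e ⌉     ≡⟨ cong suc (⌈log₂2^n⌉≡n e) ⟩
  suc e                 ∎
  where open ℕ.≤-Reasoning

log*≤273*rounds : 2 ^ (2 ℕ.+ boxSizeExponent 3 0) ℕ.≤ N → (A : Algorithm N) →
  DetectsTrianglesOn {6} (MaxDegree≤ 2) A → log* N ℕ.≤ 273 ℕ.* Algorithm.rounds A
log*≤273*rounds {N} N-large A detects = begin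
  log* N                                    ≤⟨ log*≤1+e (2 ℕ.+ (27 ℕ.+ 243 ℕ.* T)) (ℕ.<⇒≤ N-small) ⟩
  -- The additive constant 30 = 1 + 2 + 27 is absorbed using `1≤T`.
  30 ℕ.+ 243 ℕ.* T                          ≤⟨ ℕ.+-monoˡ-≤ (243 ℕ.* T) (ℕ.*-monoʳ-≤ 30 1≤T) ⟩
  30 ℕ.* T ℕ.+ 243 ℕ.* T                    ≡⟨ ℕ.*-distribʳ-+ T 30 243 ⟨
  273 ℕ.* T                                 ∎
  where
  open ℕ.≤-Reasoning

  T = Algorithm.rounds A

  N-small : N ℕ.< 2 ^ (2 ℕ.+ (27 ℕ.+ 243 ℕ.* T))
  N-small = ℕ.≰⇒> λ 2^≤N → tooFewRounds A (boxSizeExponent-3 T) 2^≤N detects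

  -- The lower bound on N is the threshold for zero rounds, so an algorithm without communication is
  -- already fooled.
  1≤T : 1 ℕ.≤ T
  1≤T = ℕ.n≢0⇒n>0 λ T≡0 →
    tooFewRounds A {boxSizeExponent 3 0} (cong (λ t → boxSizeExponent 3 (9 ℕ.* t)) T≡0) N-large detects

m≤d*n⇒1/d*m≤n : ∀ d m n .{{_ : ℕ.NonZero d}} → m ℕ.≤ d ℕ.* n → + 1 / d * (+ m / 1) ≤ + n / 1
m≤d*n⇒1/d*m≤n d@(suc _) m n m≤dn = ℚ.toℚᵘ-cancel-≤ (begin
  toℚᵘ (+ 1 / d * (+ m / 1))               ≃⟨ ℚ.toℚᵘ-homo-* (+ 1 / d) (+ m / 1) ⟩
  toℚᵘ (+ 1 / d) ℚᵘ.* toℚᵘ (+ m / 1)       ≃⟨ ℚᵘ.*-cong (ℚ.toℚᵘ-fromℚᵘ (+ 1 ℚᵘ./ d)) (ℚ.toℚᵘ-fromℚᵘ (+ m ℚᵘ./ 1)) ⟩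
  (+ 1 ℚᵘ./ d) ℚᵘ.* (+ m ℚᵘ./ 1)           ≤⟨ ℚᵘ.*≤* cross-multiplied ⟩
  + n ℚᵘ./ 1                               ≃⟨ ℚ.toℚᵘ-fromℚᵘ (+ n ℚᵘ./ 1) ⟨
  toℚᵘ (+ n / 1)                           ∎)
  where
  open ℚᵘ.≤-Reasoning

  cross-multiplied : + 1 ℤ.* + m ℤ.* + 1 ℤ.≤ + n ℤ.* + (d ℕ.* 1)
  cross-multiplied = subst₂ ℤ._≤_
    (sym (trans (ℤ.*-identityʳ (+ 1 ℤ.* + m)) (ℤ.*-identityˡ (+ m))))
    (trans (cong +_ (trans (ℕ.*-comm d n) (cong (n ℕ.*_) (sym (ℕ.*-identityʳ d))))) (ℤ.pos-* n (d ℕ.* 1)))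
    (+≤+ m≤dn)

theorem4 : Σ[ c ∈ ℚ ] (0ℚ < c) × (Σ[ N₀ ∈ ℕ ] ((N : ℕ) → N₀ ℕ.≤ N → (A : Algorithm N) →
    DetectsTrianglesOn {6} (MaxDegree≤ 2) A →
    c * (+ log* N / 1) ≤ + Algorithm.rounds A / 1))
theorem4 = + 1 / 273 , from-yes (0ℚ ℚ.<? + 1 / 273) , 2 ^ (2 ℕ.+ boxSizeExponent 3 0) , λ N N₀≤N A detects →
  m≤d*n⇒1/d*m≤n 273 (log* N) (Algorithm.rounds A) (log*≤273*rounds N₀≤N A detects)
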